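{- Let $G$ be a vertex-critical graph with $m$ edges. Then for all integers $t \geq 3m$, the graph $G \vee K_t$ is strongly chromatic-choosable.
   Context: All graphs are finite and simple. For an integer $k \geq 1$, a graph $G$ is $k$-vertex-critical if $\chi(G) = k$ and $\chi(G') < k$ for every proper induced subgraph $G'$ of $G$; $G$ is vertex-critical if it is $k$-vertex-critical for some $k \geq 1$. The join $G \vee H$ of graphs $G$ and $H$ is obtained from vertex-disjoint copies of $G$ and $H$ by making every vertex of $G$ adjacent to every vertex of $H$. $K_t$ is the complete graph on $t$ vertices. A list assignment $L$ for $G$ assigns a set $L(v)$ of colors to each $v \in V(G)$; it is a $q$-assignment if $|L(v)| = q$ for all $v$. A proper $L$-coloring is a choice of $f(v) \in L(v)$ for every $v \in V(G)$ such that adjacent vertices receive different colors. $G$ is $L$-colorable if a proper $L$-coloring exists; otherwise $L$ is bad for $G$. A $q$-assignment is constant if it assigns the same $q$-element set to every vertex. For $k \geq 1$, a graph $G$ is strongly $k$-chromatic-choosable if it is $k$-vertex-critical and every bad $(k-1)$-assignment for $G$ is constant. $G$ is strongly chromatic-choosable if it is strongly $k$-chromatic-choosable for some $k \geq 1$. -}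

module Defs where

open import Data.Bool.Base using (Bool; T)
open import Data.Fin.Base using (Fin)
import Data.Fin.Properties as Fin
open import Data.List.Base using (List; length; filter; cartesianProduct; allFin)
open import Data.List.Membership.Propositional using (_∈_)
open import Data.List.Relation.Binary.BagAndSetEquality using (_∼[_]_; set)
open import Data.List.Relation.Unary.Unique.Propositional using (Unique)
open import Data.Nat.Base using (ℕ; _≤_; _≥_; _<_; _∸_)
open import Data.Product.Base using (Σ; _×_; _,_; ∃-syntax; proj₁)
open import Data.Sum.Base using (_⊎_; inj₁; inj₂)
open import Data.Unit.Base using (⊤; tt)
open import Function.Base using (_∘_; _on_)
open import Level using (0ℓ)
open import Relation.Binary.Core using (Rel)
open import Relation.Binary.Definitions
  using (Decidable; DecidableEquality; Symmetric; Irreflexive)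
open import Relation.Binary.PropositionalEquality using (_≡_; _≢_; refl; sym)
open import Relation.Nullary using (¬_; yes; ¬?; _×-dec_)

-- Simple graphs with vertex type V.  Finite graphs are those with V = Fin n,
-- and the graphs obtained from them by joins and induced subgraphs.
record Graph (V : Set) : Set₁ where
  field
    Adj        : Rel V 0ℓ
    adj?       : Decidable Adj
    adj-sym    : Symmetric Adj
    adj-irrefl : Irreflexive _≡_ Adj

open Graph public

-- Each edge is counted once, as its pair (u , v) of endpoints with u < v.
edgeCount : ∀ {n} → Graph (Fin n) → ℕ
edgeCount {n} G =
  length (filter (λ (u , v) → (u Fin.<? v) ×-dec adj? G u v)
                 (cartesianProduct (allFin n) (allFin n)))

K : (t : ℕ) → Graph (Fin t)
K t .Adj = _≢_
K t .adj? u v = ¬? (u Fin.≟ v)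
K t .adj-sym u≢v = u≢v ∘ sym
K t .adj-irrefl u≡v u≢v = u≢v u≡v

infixr 6 _∨_

_∨_ : ∀ {V W} → Graph V → Graph W → Graph (V ⊎ W)
_∨_ {V} {W} G H = record
  { Adj        = Adj∨
  ; adj?       = adj∨?
  ; adj-sym    = λ {x} {y} → sym∨ x y
  ; adj-irrefl = λ {x} {y} → irrefl∨ x y
  }
  where
  Adj∨ : Rel (V ⊎ W) 0ℓ
  Adj∨ (inj₁ u) (inj₁ v) = Adj G u v
  Adj∨ (inj₁ _) (inj₂ _) = ⊤
  Adj∨ (inj₂ _) (inj₁ _) = ⊤
  Adj∨ (inj₂ u) (inj₂ v) = Adj H u v

  adj∨? : Decidable Adj∨
  adj∨? (inj₁ u) (inj₁ v) = adj? G u v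
  adj∨? (inj₁ _) (inj₂ _) = yes tt
  adj∨? (inj₂ _) (inj₁ _) = yes tt
  adj∨? (inj₂ u) (inj₂ v) = adj? H u v

  sym∨ : ∀ x y → Adj∨ x y → Adj∨ y x
  sym∨ (inj₁ _) (inj₁ _) a = adj-sym G a
  sym∨ (inj₁ _) (inj₂ _) _ = tt
  sym∨ (inj₂ _) (inj₁ _) _ = tt
  sym∨ (inj₂ _) (inj₂ _) a = adj-sym H a

  irrefl∨ : ∀ x y → x ≡ y → ¬ Adj∨ x y
  irrefl∨ (inj₁ _) _ refl a = adj-irrefl G refl a
  irrefl∨ (inj₂ _) _ refl a = adj-irrefl H refl a

-- The subgraph induced by a vertex subset, given by its indicator function.
-- T (S v) has at most one inhabitant, so no vertex is duplicated.
_[_] : ∀ {V} → Graph V → (S : V → Bool) → Graph (Σ V (T ∘ S))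
(G [ S ]) .Adj = Adj G on proj₁
(G [ S ]) .adj? u v = adj? G (proj₁ u) (proj₁ v)
(G [ S ]) .adj-sym = adj-sym G
(G [ S ]) .adj-irrefl refl = adj-irrefl G refl

Proper : ∀ {V C : Set} → Graph V → (V → C) → Set
Proper G f = ∀ u v → Adj G u v → f u ≢ f v

Colorable : ∀ {V} → ℕ → Graph V → Set
Colorable {V} k G = ∃[ f ] Proper {V} {Fin k} G f

-- χ(G) = k
HasChromaticNumber : ∀ {V} → Graph V → ℕ → Set
HasChromaticNumber G k = Colorable k G × (∀ j → Colorable j G → k ≤ j)

VertexCriticalAt : ∀ {V} → ℕ → Graph V → Set
VertexCriticalAt {V} k G =
  HasChromaticNumber G k ×
  (∀ (S : V → Bool) → ∃[ v ] ¬ T (S v) →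
     ∃[ j ] HasChromaticNumber (G [ S ]) j × j < k)

VertexCritical : ∀ {V} → Graph V → Set
VertexCritical G = ∃[ k ] k ≥ 1 × VertexCriticalAt k G

record FiniteSet (C : Set) : Set where
  field
    elements : List C
    unique   : Unique elements

  size : ℕ
  size = length elements

open FiniteSet public

ListAssignment : Set → Set → Set
ListAssignment V C = V → FiniteSet C

IsAssignmentOfSize : ∀ {V C} → ℕ → ListAssignment V C → Set
IsAssignmentOfSize q L = ∀ v → size (L v) ≡ q

ListColorable : ∀ {V C} → Graph V → ListAssignment V C → Set
ListColorable {V} {C} G L =
  ∃[ f ] (∀ v → f v ∈ elements (L v)) × Proper {V} {C} G f

Bad : ∀ {V C} → Graph V → ListAssignment V C → Set
Bad G L = ¬ ListColorable G L

-- Lists are compared as sets: the order of their elements is irrelevant.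
Constant : ∀ {V C} → ℕ → ListAssignment V C → Set
Constant {V} {C} q L =
  Σ (FiniteSet C) λ S → size S ≡ q × (∀ v → elements (L v) ∼[ set ] elements S)

-- The colours may come from any type with decidable equality.
StronglyChromaticChoosableAt : ∀ {V} → ℕ → Graph V → Set₁
StronglyChromaticChoosableAt {V} k G =
  VertexCriticalAt k G ×
  (∀ {C : Set} → DecidableEquality C → (L : ListAssignment V C) →
     IsAssignmentOfSize (k ∸ 1) L → Bad G L → Constant (k ∸ 1) L)

StronglyChromaticChoosable : ∀ {V} → Graph V → Set₁
StronglyChromaticChoosable G =
  ∃[ k ] k ≥ 1 × StronglyChromaticChoosableAt k G

{-# OPTIONS --safe #-}
-- Let χ(G) = κ + 1 and let L be a nonconstant (κ + t)-assignment of G ∨ K_t. Call v ∈ V(G) hard if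
-- |L(v)| ≤ deg v + t; all other vertices of G can be coloured greedily at the very end.
-- Repeatedly colour a clique vertex a by some c ∈ L(a) ∖ L(v) with v hard and delete c from all lists:
-- t drops by one but |L(v)| does not. A first step of this kind, with v possibly not hard, exists because
-- L is not constant, and from then on its vertex v₀ satisfies |L(v₀)| > κ + t. Since Σ deg v = 2m,
-- at most 2m further steps are possible before no hard vertex is left. If the process stops earlier, then
-- L(a) ⊆ L(v) for every clique vertex a and every hard v, and one colours G − v₀ by κ colours of a
-- single L(a), which leaves a choice for v₀ and then for the clique.
module Submission where

open import Defs
open import Data.Nat.Base using (ℕ; _≥_; _*_)
open import Data.Fin.Base using (Fin)
open import Relation.Binary.PropositionalEquality using (_≡_)
open import Data.Bool.Base using (Bool; true; false; T; if_then_else_)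
open import Data.Empty using (⊥; ⊥-elim)
open import Data.Fin.Base using (zero; suc; punchIn; punchOut; inject≤)
import Data.Fin.Properties as Fin
open import Data.List.Base
  using (List; []; _∷_; _++_; length; filter; map; allFin; tabulate; cartesianProduct)
import Data.List.Membership.DecPropositional as DecMembership
open import Data.List.Membership.Propositional using (_∈_; _∉_; lose; find)
open import Data.List.Membership.Propositional.Properties
  using (∈-filter⁺; ∈-filter⁻; ∈-map⁺; ∈-allFin; ∈-tabulate⁺; ∈-tabulate⁻)
open import Data.List.Properties
  using (length-map; length-tabulate; length-++; filter-all; filter-++)
open import Data.List.Relation.Binary.BagAndSetEquality using (_∼[_]_; set)
open import Data.List.Relation.Unary.All as All using ([]; _∷_)
open import Data.List.Relation.Unary.AllPairs using ([]; _∷_)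
open import Data.List.Relation.Unary.Any using (here; there; index) renaming (any? to anyList?)
open import Data.List.Relation.Unary.Unique.Propositional using (Unique)
open import Data.List.Relation.Unary.Unique.Propositional.Properties using (filter⁺)
open import Data.Nat.Base using (zero; suc; _+_; _∸_; _≤_; _<_; z≤n; s≤s)
open import Data.Nat.Properties
open import Data.Product.Base using (Σ; _×_; _,_; ∃; ∃-syntax; proj₁; proj₂)
open import Data.Sum.Base using (_⊎_; inj₁; inj₂; map₂; [_,_]′)
open import Data.Unit.Base using (tt)
open import Data.Vec.Functional using (insertAt; updateAt)
open import Data.Vec.Functional.Properties
  using (insertAt-lookup; insertAt-punchIn; updateAt-updates; updateAt-minimal)
open import Function.Base using (_∘_; const; id)
open import Function.Bundles using (mk⇔)
open import Relation.Binary.Definitions using (DecidableEquality; tri<; tri≈; tri>)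
open import Relation.Binary.PropositionalEquality
  using (_≢_; refl; sym; trans; cong; cong₂; subst; ≢-sym; module ≡-Reasoning)
open import Relation.Nullary using (¬_; Dec; yes; no; does; ¬?; _×-dec_; contradiction)
open import Relation.Nullary.Decidable
  using (⌊_⌋; toWitness; fromWitness; decidable-stable; dec-true; T?)
open import Relation.Unary using (Decidable)
open import Algebra.Properties.CommutativeMonoid.Sum +-0-commutativeMonoid
  using (sum; sum-cong-≗; ∑-comm; ∑-distrib-+)

-- Sums over a finite index set.

sum-mono : ∀ {n} {f g : Fin n → ℕ} → (∀ i → f i ≤ g i) → sum f ≤ sum g
sum-mono {zero}  _   = z≤n
sum-mono {suc n} f≤g = +-mono-≤ (f≤g zero) (sum-mono (f≤g ∘ suc))

sum-mono-< : ∀ {n} {f g : Fin n → ℕ} → (∀ i → f i ≤ g i) → ∀ i → f i < g i → sum f < sum g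
sum-mono-< f≤g zero    lt = +-mono-<-≤ lt (sum-mono (f≤g ∘ suc))
sum-mono-< f≤g (suc i) lt = +-mono-≤-< (f≤g zero) (sum-mono-< (f≤g ∘ suc) i lt)

term≤sum : ∀ {n} (f : Fin n → ℕ) i → f i ≤ sum f
term≤sum f zero    = m≤m+n _ _
term≤sum f (suc i) = m≤n⇒m≤o+n (f zero) (term≤sum (f ∘ suc) i)

-- Degrees and colourings of vertex-deleted graphs.

module _ {n} (G : Graph (Fin n)) where

  neighbours : Fin n → List (Fin n)
  neighbours v = filter (adj? G v) (allFin n)

  degree : Fin n → ℕ
  degree v = length (neighbours v)

  -- Properness ranges over all pairs of proofs of `v ≢ v₀`, so a dependence of the colour on the
  -- proof is harmless.
  DeletedColouring : ℕ → Fin n → Set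
  DeletedColouring κ v₀ =
    Σ (∀ v → v ≢ v₀ → Fin κ) λ p →
      ∀ u v u≢ v≢ → Adj G u v → p u u≢ ≢ p v v≢

-- Duplicate-free lists as finite sets.

module _ {C : Set} (_≟_ : DecidableEquality C) where

  open DecMembership _≟_ using (_∈?_)

  remove : C → List C → List C
  remove c = filter (λ x → ¬? (x ≟ c))

  infixl 6 _∖_

  _∖_ : List C → List C → List C
  xs ∖ []       = xs
  xs ∖ (z ∷ zs) = remove z xs ∖ zs

  length-remove : ∀ {c xs} → Unique xs → length xs ≤ suc (length (remove c xs))
  length-remove []                        = z≤n
  length-remove {c} {x ∷ xs} (x∉xs ∷ uniq) with x ≟ c
  ... | yes refl = s≤s (≤-reflexive (cong length (sym (filter-all _ (All.map ≢-sym x∉xs)))))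
  ... | no  _    = s≤s (length-remove uniq)

  length-∖ : ∀ {xs} zs → Unique xs → length xs ≤ length zs + length (xs ∖ zs)
  length-∖ []       uniq = ≤-refl
  length-∖ (z ∷ zs) uniq =
    ≤-trans (length-remove uniq) (s≤s (length-∖ zs (filter⁺ _ uniq)))

  ∖-unique : ∀ {xs} zs → Unique xs → Unique (xs ∖ zs)
  ∖-unique []       uniq = uniq
  ∖-unique (z ∷ zs) uniq = ∖-unique zs (filter⁺ _ uniq)

  ∈-remove⁻ : ∀ {x c xs} → x ∈ remove c xs → x ∈ xs × x ≢ c
  ∈-remove⁻ = ∈-filter⁻ _

  ∈-∖⁻ : ∀ {x xs} zs → x ∈ xs ∖ zs → x ∈ xs × x ∉ zs
  ∈-∖⁻ []       x∈ = x∈ , λ ()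
  ∈-∖⁻ (z ∷ zs) x∈ with ∈-∖⁻ zs x∈
  ... | x∈′ , x∉zs with ∈-remove⁻ x∈′
  ...   | x∈xs , x≢z = x∈xs , λ { (here x≡z) → x≢z x≡z ; (there x∈zs) → x∉zs x∈zs }

  ∈-∖⁺ : ∀ {x xs} zs → x ∈ xs → x ∉ zs → x ∈ xs ∖ zs
  ∈-∖⁺ []       x∈ _ = x∈
  ∈-∖⁺ (z ∷ zs) x∈ x∉ = ∈-∖⁺ zs (∈-filter⁺ _ x∈ (x∉ ∘ here)) (x∉ ∘ there)

  nonempty-∈ : ∀ {xs : List C} → 0 < length xs → ∃[ c ] c ∈ xs
  nonempty-∈ {x ∷ _} _ = x , here refl

  fresh : ∀ {xs} zs → Unique xs → length zs < length xs → ∃[ c ] c ∈ xs × c ∉ zs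
  fresh {xs} zs uniq lt with nonempty-∈ (+-cancelˡ-< (length zs) 0 _
    (<-≤-trans (subst (_< length xs) (sym (+-identityʳ _)) lt) (length-∖ zs uniq)))
  ... | c , c∈ = c , ∈-∖⁻ zs c∈

  ⊆-length : ∀ {xs ys} → Unique xs → (∀ {x} → x ∈ xs → x ∈ ys) → length xs ≤ length ys
  ⊆-length {xs} {ys} uniq xs⊆ys with length xs ≤? length ys
  ... | yes le = le
  ... | no ¬le with fresh ys uniq (≰⇒> ¬le)
  ...   | c , c∈xs , c∉ys = contradiction (xs⊆ys c∈xs) c∉ys

  -- An element of `ys` missing from `xs` could be put in front of `xs`, giving a duplicate-free
  -- list inside `ys` that is longer than `ys`.
  ⊆-length-⊇ : ∀ {xs ys} → Unique xs → Unique ys → length ys ≤ length xs →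
    (∀ {x} → x ∈ xs → x ∈ ys) → ∀ {y} → y ∈ ys → y ∈ xs
  ⊆-length-⊇ {xs} {ys} xs! ys! le xs⊆ys {y} y∈ys = decidable-stable (y ∈? xs) λ y∉xs →
    <⇒≱ (≤-trans (⊆-length (All.tabulate (λ x∈ y≡x → y∉xs (subst (_∈ xs) (sym y≡x) x∈)) ∷ xs!)
                  λ { (here refl) → y∈ys ; (there x∈) → xs⊆ys x∈ }) ≤-refl) le

  -- Systems of distinct representatives.

  Representatives : ∀ {s} → (Fin s → List C) → (Fin s → C) → Set
  Representatives M h = (∀ i → h i ∈ M i) × (∀ i j → h i ≡ h j → i ≡ j)

  -- The other representatives occupy only `s` colours, so the first list still has a free one. This
  -- step stands alone because `stuck` has the larger bound for list `zero` only.
  extendRepresentatives : ∀ {s} {M : Fin (suc s) → List C} {h} → Unique (M zero) →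
    s < length (M zero) → Representatives (M ∘ suc) h → ∃ (Representatives M)
  extendRepresentatives {s} {M} {h} uniq lt (h∈ , h-inj)
    with fresh (tabulate h) uniq (subst (_< length (M zero)) (sym (length-tabulate h)) lt)
  ... | c , c∈ , c∉ = h′ , h′∈ , h′-inj
    where
    h′ : Fin (suc s) → C
    h′ zero    = c
    h′ (suc i) = h i

    h′∈ : ∀ i → h′ i ∈ M i
    h′∈ zero    = c∈
    h′∈ (suc i) = h∈ i

    h′-inj : ∀ i j → h′ i ≡ h′ j → i ≡ j
    h′-inj zero    zero    _  = refl
    h′-inj zero    (suc j) eq = contradiction (subst (_∈ tabulate h) (sym eq) (∈-tabulate⁺ j)) c∉
    h′-inj (suc i) zero    eq = contradiction (subst (_∈ tabulate h) eq (∈-tabulate⁺ i)) c∉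
    h′-inj (suc i) (suc j) eq = cong suc (h-inj i j eq)

  representatives : ∀ {s} (M : Fin s → List C) → (∀ i → Unique (M i)) →
    (∀ i → s ≤ length (M i)) → ∃ (Representatives M)
  representatives {zero}  M _    _  = (λ ()) , (λ ()) , (λ ())
  representatives {suc s} M uniq le =
    extendRepresentatives (uniq zero) (le zero)
      (proj₂ (representatives (M ∘ suc) (uniq ∘ suc) (≤-trans (n≤1+n s) ∘ le ∘ suc)))

  -- Greedy list colouring and list colourings of joins.

  module _ {n} (G : Graph (Fin n)) where

    -- A partial colouring is stored as a total function; outside `D` its values are placeholders.
    ColouredOn : (M : Fin n → List C) → (Fin n → Set) → (Fin n → C) → Set
    ColouredOn M D g =
      (∀ v → D v → g v ∈ M v) × (∀ u v → D u → D v → Adj G u v → g u ≢ g v)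

    -- Even with placeholders counted, the neighbours show fewer than `length (M v)` colours. If `v`
    -- already lies in `D`, its old colour is overwritten.
    recolour : ∀ {M D g} v → Unique (M v) → degree G v < length (M v) →
      ColouredOn M D g → ∃ (ColouredOn M (λ u → u ≡ v ⊎ D u))
    recolour {M} {D} {g} v uniq lt (g∈ , g-proper)
      with fresh (map g (neighbours G v)) uniq
             (subst (_< length (M v)) (sym (length-map g (neighbours G v))) lt)
    ... | c , c∈ , c∉ = g′ , g′∈ , g′-proper
      where
      g′ : Fin n → C
      g′ = updateAt g v (const c)

      g′v≡c : g′ v ≡ c
      g′v≡c = updateAt-updates v g

      view : ∀ u → u ≡ v ⊎ D u → u ≡ v ⊎ (D u × g′ u ≡ g u)
      view u Du with u Fin.≟ v
      view u Du         | yes u≡v = inj₁ u≡v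
      view u (inj₁ u≡v) | no  u≢v = contradiction u≡v u≢v
      view u (inj₂ Du)  | no  u≢v = inj₂ (Du , updateAt-minimal u v g u≢v)

      g′∈ : ∀ u → u ≡ v ⊎ D u → g′ u ∈ M u
      g′∈ u Du with view u Du
      ... | inj₁ refl       = subst (_∈ M v) (sym g′v≡c) c∈
      ... | inj₂ (Du′ , eq) = subst (_∈ M u) (sym eq) (g∈ u Du′)

      c≢g : ∀ u → Adj G v u → c ≢ g u
      c≢g u a c≡gu = c∉ (subst (_∈ map g (neighbours G v)) (sym c≡gu)
        (∈-map⁺ g (∈-filter⁺ (adj? G v) (∈-allFin u) a)))

      g′-proper : ∀ u w → u ≡ v ⊎ D u → w ≡ v ⊎ D w → Adj G u w → g′ u ≢ g′ w
      g′-proper u w Du Dw a eq with view u Du | view w Dw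
      ... | inj₁ refl       | inj₁ refl       = adj-irrefl G refl a
      ... | inj₁ refl       | inj₂ (_ , eqw)  = c≢g w a (trans (sym g′v≡c) (trans eq eqw))
      ... | inj₂ (_ , equ)  | inj₁ refl       =
        c≢g u (adj-sym G a) (trans (sym g′v≡c) (trans (sym eq) equ))
      ... | inj₂ (Du′ , equ) | inj₂ (Dw′ , eqw) =
        g-proper u w Du′ Dw′ a (trans (sym equ) (trans eq eqw))

    recolourAll : ∀ {M D g} xs → (∀ v → Unique (M v)) →
      (∀ {v} → v ∈ xs → degree G v < length (M v)) →
      ColouredOn M D g → ∃ (ColouredOn M (λ u → u ∈ xs ⊎ D u))
    recolourAll [] _ _ (g∈ , g-proper) =
      _ , (λ { v (inj₂ Dv) → g∈ v Dv }) ,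
          (λ { u v (inj₂ Du) (inj₂ Dv) → g-proper u v Du Dv })
    recolourAll {D = D} (x ∷ xs) uniq lt col
      with recolour x (uniq x) (lt (here refl)) (proj₂ (recolourAll xs uniq (lt ∘ there) col))
    ... | g′ , g′∈ , g′-proper =
      g′ , (λ v → g′∈ v ∘ split) , (λ u v Du Dv → g′-proper u v (split Du) (split Dv))
      where
      split : ∀ {u} → u ∈ x ∷ xs ⊎ D u → u ≡ x ⊎ (u ∈ xs ⊎ D u)
      split (inj₁ (here u≡x))  = inj₁ u≡x
      split (inj₁ (there u∈))  = inj₂ (inj₁ u∈)
      split (inj₂ Du)          = inj₂ (inj₂ Du)

    -- The two sides of the join are kept apart: proper on the clique means injective, and the last
    -- component covers the edges between the sides.
    JoinColourable : ∀ {s} → (Fin n → List C) → (Fin s → List C) → Set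
    JoinColourable {s} LV LA =
      ∃[ g ] ∃[ h ] (∀ v → g v ∈ LV v) × Proper {Fin n} {C} G g ×
        Representatives {s} LA h × (∀ v i → g v ≢ h i)

    -- With `c` deleted from all other lists, no other vertex can receive it, so giving it to clique
    -- vertex `i` causes no conflict. `punchIn i` enumerates the remaining clique vertices.
    precolour : ∀ {s LV} {LA : Fin (suc s) → List C} i c → c ∈ LA i →
      JoinColourable (remove c ∘ LV) (remove c ∘ LA ∘ punchIn i) → JoinColourable LV LA
    precolour {s} {LV} {LA} i c c∈ (g , h , g∈ , g-proper , (h∈ , h-inj) , g≢h) =
      g , h′ , proj₁ ∘ ∈-remove⁻ ∘ g∈ , g-proper , (h′∈ , h′-inj) , g≢h′
      where
      h′ : Fin (suc s) → C
      h′ = insertAt h i c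

      view : ∀ j → (j ≡ i × h′ j ≡ c) ⊎ ∃[ l ] j ≡ punchIn i l × h′ j ≡ h l
      view j with i Fin.≟ j
      ... | yes refl = inj₁ (refl , insertAt-lookup h i c)
      ... | no i≢j   = inj₂ (punchOut i≢j , sym (Fin.punchIn-punchOut i≢j) ,
        trans (cong h′ (sym (Fin.punchIn-punchOut i≢j))) (insertAt-punchIn h i c _))

      h≢c : ∀ l → h l ≢ c
      h≢c l = proj₂ (∈-remove⁻ {xs = LA (punchIn i l)} (h∈ l))

      h′∈ : ∀ j → h′ j ∈ LA j
      h′∈ j with view j
      ... | inj₁ (refl , eq)     = subst (_∈ LA i) (sym eq) c∈
      ... | inj₂ (l , refl , eq) = subst (_∈ LA j) (sym eq) (proj₁ (∈-remove⁻ (h∈ l)))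

      h′-inj : ∀ j k → h′ j ≡ h′ k → j ≡ k
      h′-inj j k eq with view j | view k
      ... | inj₁ (refl , _)        | inj₁ (refl , _)        = refl
      ... | inj₁ (_ , eqj)         | inj₂ (l , _ , eqk)     =
        contradiction (trans (sym eqk) (trans (sym eq) eqj)) (h≢c l)
      ... | inj₂ (l , _ , eqj)     | inj₁ (_ , eqk)         =
        contradiction (trans (sym eqj) (trans eq eqk)) (h≢c l)
      ... | inj₂ (l , refl , eqj)  | inj₂ (l′ , refl , eqk) =
        cong (punchIn i) (h-inj l l′ (trans (sym eqj) (trans eq eqk)))

      g≢h′ : ∀ v j → g v ≢ h′ j
      g≢h′ v j eq with view j
      ... | inj₁ (_ , eqj)     = proj₂ (∈-remove⁻ {xs = LV v} (g∈ v)) (trans eq eqj)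
      ... | inj₂ (l , _ , eqj) = g≢h v l (trans eq eqj)

    -- The clique keeps `h`. Deleting its `s` colours leaves an easy vertex more colours than its
    -- degree and does not touch `g` on `D`, so the greedy extension applies.
    colourRest : ∀ {s LV} {LA : Fin s → List C} {D g h} → (∀ v → Unique (LV v)) →
      (∀ v → degree G v + s < length (LV v) ⊎ D v) →
      ColouredOn LV D g → Representatives LA h → (∀ v i → D v → g v ≢ h i) →
      JoinColourable LV LA
    colourRest {s} {LV} {LA} {D} {g} {h} uniq cover (g∈ , g-proper) rep g≢h =
      proj₁ col , h , proj₁ ∘ mem , (λ u v → proj₂ (proj₂ col) u v (total u) (total v)) , rep ,
      λ v i eq → proj₂ (mem v) (subst (_∈ tabulate h) (sym eq) (∈-tabulate⁺ i))
      where
      M : Fin n → List C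
      M v = LV v ∖ tabulate h

      Easy : Fin n → Set
      Easy v = degree G v + s < length (LV v)

      easy? : ∀ v → Dec (Easy v)
      easy? v = _ <? _

      xs : List (Fin n)
      xs = filter easy? (allFin n)

      enough : ∀ {v} → v ∈ xs → degree G v < length (M v)
      enough {v} v∈ = +-cancelʳ-< s _ _ (<-≤-trans (proj₂ (∈-filter⁻ easy? {xs = allFin n} v∈))
        (≤-trans (length-∖ (tabulate h) (uniq v))
          (≤-reflexive (trans (+-comm _ (length (M v)))
            (cong (length (M v) +_) (length-tabulate h))))))

      col : ∃ (ColouredOn M (λ v → v ∈ xs ⊎ D v))
      col = recolourAll xs (∖-unique (tabulate h) ∘ uniq) enough
        ((λ v Dv → ∈-∖⁺ (tabulate h) (g∈ v Dv) λ gv∈ →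
            let i , eq = ∈-tabulate⁻ gv∈ in g≢h v i Dv eq) , g-proper)

      total : ∀ v → v ∈ xs ⊎ D v
      total v with cover v
      ... | inj₁ e  = inj₁ (∈-filter⁺ easy? (∈-allFin v) e)
      ... | inj₂ Dv = inj₂ Dv

      mem : ∀ v → proj₁ col v ∈ LV v × proj₁ col v ∉ tabulate h
      mem v = ∈-∖⁻ (tabulate h) (proj₁ (proj₂ col) v (total v))

    colourAround : ∀ {κ} v₀ → DeletedColouring G κ v₀ → ∀ c (β : Fin κ → C) →
      (∀ i j → β i ≡ β j → i ≡ j) → (∀ j → β j ≢ c) →
      ∃[ g ] (∀ v → (v ≡ v₀ × g v ≡ c) ⊎ (v ≢ v₀ × ∃[ j ] g v ≡ β j)) × Proper G g
    colourAround {κ} v₀ (p , p-proper) c β β-inj β≢c = g , view , g-proper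
      where
      g : Fin n → C
      g v with v Fin.≟ v₀
      ... | yes _ = c
      ... | no v≢ = β (p v v≢)

      view : ∀ v → (v ≡ v₀ × g v ≡ c) ⊎ (v ≢ v₀ × ∃[ j ] g v ≡ β j)
      view v with v Fin.≟ v₀
      ... | yes v≡ = inj₁ (v≡ , refl)
      ... | no v≢  = inj₂ (v≢ , p v v≢ , refl)

      g-proper : Proper G g
      g-proper u v a with u Fin.≟ v₀ | v Fin.≟ v₀
      ... | yes refl | yes refl = λ _ → adj-irrefl G refl a
      ... | yes _    | no  _    = β≢c _ ∘ sym
      ... | no  _    | yes _    = β≢c _
      ... | no  u≢   | no  v≢   = p-proper u v u≢ v≢ a ∘ β-inj _ _

    -- The colouring process on the clique.

    module _ (κ : ℕ) (critical : ∀ v₀ → DeletedColouring G κ v₀) where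

      -- An upper bound for the number of colouring steps until no vertex is hard.
      demand : ℕ → (Fin n → List C) → ℕ
      demand s LV = sum λ v → suc (degree G v + s) ∸ length (LV v)

      Hard : ℕ → (Fin n → List C) → Fin n → Set
      Hard s LV v = length (LV v) ≤ degree G v + s

      -- Every minuend drops by one and a list loses at most one colour, so no term grows. At `v`
      -- the list stays intact, and hardness makes the old term positive, so the truncated
      -- difference really drops.
      demand-remove : ∀ {s LV v c} → (∀ w → Unique (LV w)) → Hard (suc s) LV v → c ∉ LV v →
        demand s (remove c ∘ LV) < demand (suc s) LV
      demand-remove {s} {LV} {v} {c} uniq hard c∉ = sum-mono-< weak v strict
        where
        weak : ∀ w → suc (degree G w + s) ∸ length (remove c (LV w)) ≤
                     suc (degree G w + suc s) ∸ length (LV w)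
        weak w rewrite +-suc (degree G w) s =
          ∸-monoʳ-≤ (suc (suc (degree G w + s))) (length-remove {c} (uniq w))

        strict : suc (degree G v + s) ∸ length (remove c (LV v)) <
                 suc (degree G v + suc s) ∸ length (LV v)
        strict rewrite filter-all (λ x → ¬? (x ≟ c))
                         (All.tabulate {xs = LV v} λ x∈ x≡c → c∉ (subst (_∈ LV v) x≡c x∈))
                     | +-suc (degree G v) s =
          ≤-reflexive (sym (+-∸-assoc 1 hard))

      -- Colour G − v₀ by κ colours of LA zero and v₀ by a colour c for which LA zero keeps s + 1
      -- colours. The other s clique vertices keep at least s colours each; zero is coloured last.
      stuck : ∀ {s LV} {LA : Fin (suc s) → List C} v₀ → (∀ v → Unique (LV v)) →
        (∀ i → Unique (LA i)) → (∀ i → κ + suc s ≤ length (LA i)) →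
        κ + suc s < length (LV v₀) →
        (∀ v {c} → Hard (suc s) LV v → c ∈ LA zero → c ∈ LV v) → JoinColourable LV LA
      stuck {s} {LV} {LA} v₀ LV! LA! LA≥ v₀≥ LA⊆LV =
        colourRest {D = λ v → Hard (suc s) LV v ⊎ v ≡ v₀} LV! cover
          ((λ v → g∈ v) , λ u v _ _ → g-proper u v)
          ((λ i → proj₁ (∈-∖⁻ {xs = LA i} used (proj₁ (proj₂ clique) i))) ,
           proj₂ (proj₂ clique))
          λ v i _ eq → proj₂ (∈-∖⁻ {xs = LA i} used (proj₁ (proj₂ clique) i))
            (subst (_∈ used) eq (g-used v))
        where
        B : List C
        B = LA zero

        -- If `LV v₀` has a colour outside `B`, deleting it from `B` costs nothing. Otherwise
        -- `LV v₀` is contained in `B`, which then has more than `κ + suc s` elements and can afford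
        -- to lose one.
        spare : ∃[ c ] c ∈ LV v₀ × κ + suc s ≤ length (remove c B)
        spare with anyList? (λ c → ¬? (c ∈? B)) (LV v₀)
        ... | yes some with find some
        ...   | c , c∈ , c∉ = c , c∈ , subst (λ l → κ + suc s ≤ length l)
          (sym (filter-all _ (All.tabulate λ x∈ x≡c → c∉ (subst (_∈ B) x≡c x∈)))) (LA≥ zero)
        spare | no none with nonempty-∈ (≤-trans (s≤s z≤n) v₀≥)
        ...   | c , c∈ = c , c∈ , ≤-pred (≤-trans (≤-trans v₀≥
          (⊆-length (LV! v₀) λ {x} x∈ → decidable-stable (x ∈? B) λ x∉ → none (lose x∈ x∉)))
          (length-remove (LA! zero)))

        c : C
        c = proj₁ spare

        B′ : List C
        B′ = remove c B

        palette : ∃ (Representatives {κ} (const B′))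
        palette = representatives (const B′) (const (filter⁺ _ (LA! zero)))
          (const (m+n≤o⇒m≤o κ (proj₂ (proj₂ spare))))

        β : Fin κ → C
        β = proj₁ palette

        β∈ : ∀ j → β j ∈ B × β j ≢ c
        β∈ j = ∈-remove⁻ (proj₁ (proj₂ palette) j)

        used : List C
        used = c ∷ tabulate β

        core : ∃[ g ] (∀ v → (v ≡ v₀ × g v ≡ c) ⊎ (v ≢ v₀ × ∃[ j ] g v ≡ β j)) × Proper G g
        core = colourAround v₀ (critical v₀) c β (proj₂ (proj₂ palette)) (proj₂ ∘ β∈)

        g : Fin n → C
        g = proj₁ core

        g-proper : Proper G g
        g-proper = proj₂ (proj₂ core)

        g-used : ∀ v → g v ∈ used
        g-used v with proj₁ (proj₂ core) v
        ... | inj₁ (_ , eq) = here eq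
        ... | inj₂ (_ , j , eq) = there (subst (_∈ tabulate β) (sym eq) (∈-tabulate⁺ j))

        -- A hard vertex other than `v₀` gets some `β j`, which comes from `B` and hence lies in its
        -- list. Easy vertices may hold foreign colours until `colourRest` replaces them.
        g∈ : ∀ v → Hard (suc s) LV v ⊎ v ≡ v₀ → g v ∈ LV v
        g∈ v D with proj₁ (proj₂ core) v | D
        ... | inj₁ (refl , eq)   | _         = subst (_∈ LV v) (sym eq) (proj₁ (proj₂ spare))
        ... | inj₂ (_ , j , eq)  | inj₁ hard =
          subst (_∈ LV v) (sym eq) (LA⊆LV v hard (proj₁ (β∈ j)))
        ... | inj₂ (v≢ , _)      | inj₂ v≡   = contradiction v≡ v≢

        cover : ∀ v → degree G v + suc s < length (LV v) ⊎ (Hard (suc s) LV v ⊎ v ≡ v₀)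
        cover v with (degree G v + suc s) <? length (LV v)
        ... | yes easy = inj₁ easy
        ... | no ¬easy = inj₂ (inj₁ (≮⇒≥ ¬easy))

        tail≥ : ∀ i → s ≤ length (LA i ∖ used)
        tail≥ i = +-cancelˡ-≤ (suc κ) _ _ (≤-trans (≤-reflexive (sym (+-suc κ s)))
          (≤-trans (LA≥ i) (≤-trans (length-∖ used (LA! i))
            (≤-reflexive (cong (λ l → suc l + length (LA i ∖ used)) (length-tabulate β))))))

        -- Deleting `used` from `B` unfolds to deleting the `β j` from `B′`. The bound in `spare`
        -- already accounts for `c`, so only κ colours are subtracted from `κ + suc s`.
        head> : s < length (B ∖ used)
        head> = +-cancelˡ-≤ κ _ _ (≤-trans (proj₂ (proj₂ spare))
          (≤-trans (length-∖ (tabulate β) (filter⁺ _ (LA! zero)))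
            (≤-reflexive (cong (_+ length (B ∖ used)) (length-tabulate β)))))

        clique : ∃ (Representatives (λ i → LA i ∖ used))
        clique = extendRepresentatives (∖-unique used (LA! zero)) head>
          (proj₂ (representatives (λ i → LA (suc i) ∖ used)
            (∖-unique used ∘ LA! ∘ suc) (tail≥ ∘ suc)))

      -- Induction on `s`. A step lowers `s` by one, the demand by at least one and each list by at
      -- most one colour, so the bounds carry over.
      joinColourable : ∀ s LV (LA : Fin s → List C) v₀ → (∀ v → Unique (LV v)) →
        (∀ i → Unique (LA i)) → (∀ i → κ + s ≤ length (LA i)) → κ + s < length (LV v₀) →
        demand s LV ≤ s → JoinColourable LV LA
      joinColourable zero LV LA v₀ LV! LA! _ v₀≥ le =
        -- Demand 0 makes every vertex easy, so `D` can be empty and the colour from `LV v₀` is a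
        -- mere placeholder.
        colourRest {D = λ _ → ⊥} {g = λ _ → proj₁ colour} {h = λ ()} LV! (inj₁ ∘ easy)
          ((λ _ ()) , λ _ _ ()) ((λ ()) , λ ()) λ _ ()
        where
        colour : ∃[ c ] c ∈ LV v₀
        colour = nonempty-∈ (≤-trans (s≤s z≤n) v₀≥)

        easy : ∀ v → degree G v + 0 < length (LV v)
        easy v = m∸n≡0⇒m≤n (n≤0⇒n≡0 (≤-trans (term≤sum _ v) le))
      joinColourable (suc s) LV LA v₀ LV! LA! LA≥ v₀≥ le
        with Fin.any? (λ i → Fin.any? λ v →
               (length (LV v) ≤? degree G v + suc s) ×-dec anyList? (λ c → ¬? (c ∈? LV v)) (LA i))
      ... | yes (i , v , hard , some) with find some
      ...   | c , c∈ , c∉ = precolour i c c∈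
        (joinColourable s (remove c ∘ LV) (remove c ∘ LA ∘ punchIn i) v₀
          (filter⁺ _ ∘ LV!) (filter⁺ _ ∘ LA! ∘ punchIn i)
          (λ j → shrink (LA! (punchIn i j)) (LA≥ (punchIn i j)))
          (shrink (LV! v₀) v₀≥)
          (≤-pred (≤-trans (demand-remove LV! hard c∉) le)))
        where
        shrink : ∀ {xs m} → Unique xs → m + suc s ≤ length xs → m + s ≤ length (remove c xs)
        shrink {m = m} uniq le′ = ≤-pred (≤-trans (≤-reflexive (sym (+-suc m s)))
          (≤-trans le′ (length-remove uniq)))
      joinColourable (suc s) LV LA v₀ LV! LA! LA≥ v₀≥ le | no none =
        stuck v₀ LV! LA! LA≥ v₀≥ λ v {c} hard c∈ →
          decidable-stable (c ∈? LV v) λ c∉ → none (zero , v , hard , lose c∈ c∉)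

-- The degree sum and the number of edges.

indicator : Bool → ℕ
indicator b = if b then 1 else 0

length-filter-map : ∀ {A B : Set} {P : B → Set} (P? : Decidable P) (f : A → B) xs →
  length (filter P? (map f xs)) ≡ length (filter (P? ∘ f) xs)
length-filter-map P? f []       = refl
length-filter-map P? f (x ∷ xs) with does (P? (f x))
... | true  = cong suc (length-filter-map P? f xs)
... | false = length-filter-map P? f xs

length-filter-tabulate : ∀ {A : Set} {P : A → Set} (P? : Decidable P) {n} (f : Fin n → A) →
  length (filter P? (tabulate f)) ≡ sum (indicator ∘ does ∘ P? ∘ f)
length-filter-tabulate P? {zero}  f = refl
length-filter-tabulate P? {suc n} f with does (P? (f zero))
... | true  = cong suc (length-filter-tabulate P? (f ∘ suc))
... | false = length-filter-tabulate P? (f ∘ suc)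

length-filter-cartesianProduct : ∀ {A B : Set} {P : A × B → Set} (P? : Decidable P)
  {n} (f : Fin n → A) ys →
  length (filter P? (cartesianProduct (tabulate f) ys)) ≡
  sum (λ i → length (filter (λ y → P? (f i , y)) ys))
length-filter-cartesianProduct P? {zero}  f ys = refl
length-filter-cartesianProduct P? {suc n} f ys = begin
  length (filter P? (map (f zero ,_) ys ++ rest))
    ≡⟨ cong length (filter-++ P? (map (f zero ,_) ys) rest) ⟩
  length (filter P? (map (f zero ,_) ys) ++ filter P? rest)
    ≡⟨ length-++ (filter P? (map (f zero ,_) ys)) ⟩
  length (filter P? (map (f zero ,_) ys)) + length (filter P? rest)
    ≡⟨ cong₂ _+_ (length-filter-map P? (f zero ,_) ys)
                 (length-filter-cartesianProduct P? (f ∘ suc) ys) ⟩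
  sum (λ i → length (filter (λ y → P? (f i , y)) ys)) ∎
  where
  open ≡-Reasoning
  rest = cartesianProduct (tabulate (f ∘ suc)) ys

-- An adjacent pair satisfies `v < u` or `u < v`, so `e v u` or `e u v` counts it. Exchanging the
-- order of summation in the second half gives `edgeCount G` twice.
handshake : ∀ {n} (G : Graph (Fin n)) → sum (degree G) ≤ edgeCount G + edgeCount G
handshake {n} G = begin
  sum (degree G)
    ≡⟨ sum-cong-≗ (λ v → length-filter-tabulate (adj? G v) id) ⟩
  sum (λ v → sum (λ u → indicator (does (adj? G v u))))
    ≤⟨ sum-mono (λ v → sum-mono (λ u → adj≤ v u)) ⟩
  sum (λ v → sum (λ u → e v u + e u v))
    ≡⟨ sum-cong-≗ (λ v → ∑-distrib-+ (e v) (λ u → e u v)) ⟩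
  sum (λ v → sum (e v) + sum (λ u → e u v))
    ≡⟨ ∑-distrib-+ (sum ∘ e) (λ v → sum (λ u → e u v)) ⟩
  sum (sum ∘ e) + sum (λ v → sum (λ u → e u v))
    ≡⟨ cong (sum (sum ∘ e) +_) (∑-comm (λ v u → e u v)) ⟩
  sum (sum ∘ e) + sum (sum ∘ e)
    ≡⟨ cong₂ _+_ ∑e≡m ∑e≡m ⟩
  edgeCount G + edgeCount G ∎
  where
  open ≤-Reasoning

  edge? : Decidable (λ ((u , v) : Fin n × Fin n) → _)
  edge? (u , v) = (u Fin.<? v) ×-dec adj? G u v

  e : Fin n → Fin n → ℕ
  e u v = indicator (does (edge? (u , v)))

  ∑e≡m : sum (sum ∘ e) ≡ edgeCount G
  ∑e≡m = trans (sum-cong-≗ (λ u → sym (length-filter-tabulate (λ v → edge? (u , v)) id)))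
               (sym (length-filter-cartesianProduct edge? id (allFin n)))

  adj≤ : ∀ v u → indicator (does (adj? G v u)) ≤ e v u + e u v
  adj≤ v u with adj? G v u
  ... | no _  = z≤n
  ... | yes a with Fin.<-cmp v u
  ...   | tri< v<u _ _  rewrite dec-true (v Fin.<? u) v<u = s≤s z≤n
  ...   | tri≈ _ refl _ = contradiction a (adj-irrefl G refl)
  ...   | tri> _ _ u<v  rewrite dec-true (edge? (u , v)) (u<v , adj-sym G a) = m≤n+m 1 _

-- Chromatic number and criticality of joins with a clique.

count : ∀ {t} → (Fin t → Bool) → ℕ
count S = sum (indicator ∘ S)

count≤ : ∀ {t} (S : Fin t → Bool) → count S ≤ t
count≤ {zero}  S = z≤n
count≤ {suc t} S with S zero
... | true  = s≤s (count≤ (S ∘ suc))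
... | false = m≤n⇒m≤1+n (count≤ (S ∘ suc))

count< : ∀ {t} (S : Fin t → Bool) i → ¬ T (S i) → count S < t
count< S zero    ¬p with S zero
... | true  = contradiction tt ¬p
... | false = s≤s (count≤ (S ∘ suc))
count< S (suc i) ¬p with S zero
... | true  = s≤s (count< (S ∘ suc) i ¬p)
... | false = m≤n⇒m≤1+n (count< (S ∘ suc) i ¬p)

count-full : ∀ t → count {t} (const true) ≡ t
count-full zero    = refl
count-full (suc t) = cong suc (count-full t)

pullback : ∀ {V W} (X : Graph V) (Y : Graph W) (φ : V → W) →
  (∀ u v → Adj X u v → Adj Y (φ u) (φ v)) → ∀ {j} → Colorable j Y → Colorable j X
pullback X Y φ hom (f , proper) = f ∘ φ , λ u v a → proper (φ u) (φ v) (hom u v a)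

χ-transfer : ∀ {V W} (X : Graph V) (Y : Graph W) {j} →
  (∀ {i} → Colorable i X → Colorable i Y) → (∀ {i} → Colorable i Y → Colorable i X) →
  HasChromaticNumber X j → HasChromaticNumber Y j
χ-transfer X Y to from (col , least) = to col , λ i → least i ∘ from

fromSubgraph : ∀ {V} (G : Graph V) S → (∀ v → T (S v)) → ∀ {i} →
  Colorable i (G [ S ]) → Colorable i G
fromSubgraph G S full = pullback G (G [ S ]) (λ v → v , full v) (λ _ _ a → a)

toSubgraph : ∀ {V} (G : Graph V) S {i} → Colorable i G → Colorable i (G [ S ])
toSubgraph G S = pullback (G [ S ]) G proj₁ (λ _ _ a → a)

shift : ∀ {V : Set} {t} → V ⊎ Fin t → V ⊎ Fin (suc t)
shift = map₂ suc

module _ {V : Set} (G : Graph V) where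

  shift-adj : ∀ {t} (x y : V ⊎ Fin t) →
    Adj (G ∨ K t) x y → Adj (G ∨ K (suc t)) (shift x) (shift y)
  shift-adj (inj₁ _) (inj₁ _) a = a
  shift-adj (inj₁ _) (inj₂ _) _ = tt
  shift-adj (inj₂ _) (inj₁ _) _ = tt
  shift-adj (inj₂ _) (inj₂ _) a = a ∘ Fin.suc-injective

  apex-adj : ∀ {t} (x : V ⊎ Fin t) → Adj (G ∨ K (suc t)) (inj₂ zero) (shift x)
  apex-adj (inj₁ _) = tt
  apex-adj (inj₂ _) = λ ()

  module _ {t} (S : V ⊎ Fin (suc t) → Bool) where

    private
      H  = (G ∨ K (suc t)) [ S ]
      H′ = (G ∨ K t) [ S ∘ shift ]

    unshift : ∀ {i} → Colorable i H → Colorable i H′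
    unshift = pullback H′ H (λ (x , p) → shift x , p) (λ (x , _) (y , _) → shift-adj x y)

    reshift : ∀ {i} → ¬ T (S (inj₂ zero)) → Colorable i H′ → Colorable i H
    reshift {i} absent (f , proper) = pullback H H′ φ hom (f , proper)
      where
      φ : Σ (V ⊎ Fin (suc t)) (T ∘ S) → Σ (V ⊎ Fin t) (T ∘ S ∘ shift)
      φ (inj₁ v , p)       = inj₁ v , p
      φ (inj₂ zero , p)    = contradiction p absent
      φ (inj₂ (suc i) , p) = inj₂ i , p

      hom : ∀ x y → Adj H x y → Adj H′ (φ x) (φ y)
      hom (inj₁ _ , _)       (inj₁ _ , _)       a = a
      hom (inj₁ _ , _)       (inj₂ (suc _) , _) _ = tt
      hom (inj₂ (suc _) , _) (inj₁ _ , _)       _ = tt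
      hom (inj₂ (suc _) , _) (inj₂ (suc _) , _) a = a ∘ cong suc
      hom (inj₂ zero , p)    _                  _ = contradiction p absent
      hom (inj₁ _ , _)       (inj₂ zero , p)    _ = contradiction p absent
      hom (inj₂ (suc _) , _) (inj₂ zero , p)    _ = contradiction p absent

    addApex : ∀ {i} → Colorable i H′ → Colorable (suc i) H
    addApex {i} (f , proper) = f′ , proper′
      where
      f′ : Σ (V ⊎ Fin (suc t)) (T ∘ S) → Fin (suc i)
      f′ (inj₁ v , p)       = suc (f (inj₁ v , p))
      f′ (inj₂ zero , p)    = zero
      f′ (inj₂ (suc i) , p) = suc (f (inj₂ i , p))

      proper′ : Proper H f′
      proper′ (inj₁ _ , _)       (inj₁ _ , _)       a = proper _ _ a ∘ Fin.suc-injective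
      proper′ (inj₁ _ , _)       (inj₂ (suc _) , _) a = proper _ _ tt ∘ Fin.suc-injective
      proper′ (inj₂ (suc _) , _) (inj₁ _ , _)       a = proper _ _ tt ∘ Fin.suc-injective
      proper′ (inj₂ (suc _) , _) (inj₂ (suc _) , _) a =
        proper _ _ (a ∘ cong suc) ∘ Fin.suc-injective
      proper′ (inj₁ _ , _)       (inj₂ zero , _)    _ = λ ()
      proper′ (inj₂ zero , _)    (inj₁ _ , _)       _ = λ ()
      proper′ (inj₂ zero , _)    (inj₂ zero , _)    a = contradiction refl a
      proper′ (inj₂ zero , _)    (inj₂ (suc _) , _) _ = λ ()
      proper′ (inj₂ (suc _) , _) (inj₂ zero , _)    _ = λ ()

    -- The apex is adjacent to all other vertices of `H`, so its colour occurs nowhere else and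
    -- `punchOut` can strike it out. The apex itself forces `i` to be positive.
    removeApex : T (S (inj₂ zero)) → ∀ {i} → Colorable i H → ∃[ i′ ] i ≡ suc i′ × Colorable i′ H′
    removeApex present {zero}  (f , _) = ⊥-elim (Fin.¬Fin0 (f (inj₂ zero , present)))
    removeApex present {suc i} (f , proper) = i , refl ,
      (λ (x , p) → punchOut (avoid x p)) ,
      λ (x , p) (y , q) a → proper _ _ (shift-adj x y a) ∘ Fin.punchOut-injective (avoid x p) (avoid y q)
      where
      avoid : ∀ x p → f (inj₂ zero , present) ≢ f (shift x , p)
      avoid x p = proper _ _ (apex-adj x)

    χ-apex : ∀ {j} → T (S (inj₂ zero)) → HasChromaticNumber H′ j → HasChromaticNumber H (suc j)
    χ-apex {j} present (col , least) = addApex col , λ i → least′ i ∘ removeApex present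
      where
      least′ : ∀ i → ∃[ i′ ] i ≡ suc i′ × Colorable i′ H′ → suc j ≤ i
      least′ _ (i′ , refl , col′) = s≤s (least i′ col′)

  -- Clique vertices are added one at a time: one inside `S` is an apex and raises the chromatic
  -- number by one, one outside `S` changes nothing.
  χ-join : ∀ t (S : V ⊎ Fin t → Bool) {j} → HasChromaticNumber (G [ S ∘ inj₁ ]) j →
    HasChromaticNumber ((G ∨ K t) [ S ]) (count (S ∘ inj₂) + j)
  χ-join zero S χ = χ-transfer X Y
    (pullback Y X (λ { (inj₁ v , p) → v , p }) (λ { (inj₁ _ , _) (inj₁ _ , _) a → a }))
    (pullback X Y (λ (v , p) → inj₁ v , p) (λ _ _ a → a)) χ
    where
    X = G [ S ∘ inj₁ ]
    Y = (G ∨ K zero) [ S ]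
  χ-join (suc t) S χ with χ-join t (S ∘ shift) χ | S (inj₂ zero) in eq
  ... | ih | true  = χ-apex S (subst T (sym eq) tt) ih
  ... | ih | false = χ-transfer ((G ∨ K t) [ S ∘ shift ]) ((G ∨ K (suc t)) [ S ])
    (reshift S (subst T eq)) (unshift S) ih

χ-joinFull : ∀ {V} (G : Graph V) {k} t →
  HasChromaticNumber G k → HasChromaticNumber (G ∨ K t) (t + k)
χ-joinFull G {k} t χ =
  subst (λ c → HasChromaticNumber (G ∨ K t) (c + k)) (count-full t)
    (χ-transfer ((G ∨ K t) [ const true ]) (G ∨ K t)
      (fromSubgraph (G ∨ K t) (const true) (const tt)) (toSubgraph (G ∨ K t) (const true))
      (χ-join G t (const true)
        (χ-transfer G (G [ const true ])
          (toSubgraph G (const true)) (fromSubgraph G (const true) (const tt)) χ)))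

-- If `S` misses a vertex of `G`, criticality of `G` lowers the second summand in `χ-join`.
-- Otherwise `S` misses a clique vertex and the count falls below `t`.
join-critical : ∀ {n} (G : Graph (Fin n)) {k} t →
  VertexCriticalAt k G → VertexCriticalAt (t + k) (G ∨ K t)
join-critical G {k} t (χ , critical) = χ-joinFull G t χ , proper
  where
  proper : ∀ S → ∃[ x ] ¬ T (S x) →
    ∃[ j ] HasChromaticNumber ((G ∨ K t) [ S ]) j × j < t + k
  proper S (x , x∉S) with Fin.any? (λ v → ¬? (T? (S (inj₁ v))))
  ... | yes some with critical (S ∘ inj₁) some
  ...   | j , χj , j<k = _ , χ-join G t S χj , +-mono-≤-< (count≤ (S ∘ inj₂)) j<k
  proper S (inj₁ v , v∉S) | no none = contradiction (v , v∉S) none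
  proper S (inj₂ i , i∉S) | no none =
    _ , χ-join G t S (χ-transfer G (G [ S ∘ inj₁ ])
      (toSubgraph G (S ∘ inj₁)) (fromSubgraph G (S ∘ inj₁) all) χ) ,
    +-monoˡ-< k (count< (S ∘ inj₂) i i∉S)
    where
    all : ∀ v → T (S (inj₁ v))
    all v = decidable-stable (T? _) λ v∉S → none (v , v∉S)

-- Consequences of criticality and of the edge bound.

deletedColouring : ∀ {n κ} (G : Graph (Fin n)) → VertexCriticalAt (suc κ) G →
  ∀ v₀ → DeletedColouring G κ v₀
deletedColouring G (_ , critical) v₀
  with critical (λ v → ⌊ ¬? (v Fin.≟ v₀) ⌋)
         (v₀ , λ p → toWitness {a? = ¬? (v₀ Fin.≟ v₀)} p refl)
... | j , ((f , proper) , _) , s≤s j≤κ =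
  (λ v v≢ → inject≤ (f (v , fromWitness v≢)) j≤κ) ,
  λ u v u≢ v≢ a → proper _ _ a ∘ Fin.inject≤-injective j≤κ j≤κ _ _

-- By `handshake` all degrees vanish, so one colour suffices. This settles `t = 0`, where there are
-- no edges and all lists turn out empty.
edgeless-χ : ∀ {n κ} (G : Graph (Fin n)) → HasChromaticNumber G (suc κ) → edgeCount G ≡ 0 → κ ≡ 0
edgeless-χ G (_ , least) m≡0 =
  n≤0⇒n≡0 (≤-pred (least 1 ((λ _ → zero) , λ u v a _ → noEdge u v a)))
  where
  noEdge : ∀ u v → ¬ Adj G u v
  noEdge u v a = Fin.¬Fin0 (subst Fin deg≡0 (index (∈-filter⁺ (adj? G u) (∈-allFin v) a)))
    where
    deg≡0 : degree G u ≡ 0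
    deg≡0 = n≤0⇒n≡0 (≤-trans (term≤sum (degree G) u)
      (≤-trans (handshake G) (≤-reflexive (cong₂ _+_ m≡0 m≡0))))

-- Here the bound 3m enters, with `t = suc s`: the first colouring step spends one clique vertex,
-- and 2m must remain. For m ≥ 1 the third m pays for that step.
double≤ : ∀ m {s} → 3 * m ≤ suc s → m + m ≤ s
double≤ zero    _        = z≤n
double≤ (suc m) (s≤s le) = ≤-trans
  (≤-trans (≤-reflexive (cong (suc m +_) (sym (+-identityʳ (suc m))))) (m≤n+m _ m)) le

length≡0 : ∀ {A : Set} {xs : List A} → length xs ≡ 0 → xs ≡ []
length≡0 {xs = []} _ = refl

-- Bad assignments are constant.

module _ {n} (G : Graph (Fin n)) {κ} (critical : VertexCriticalAt (suc κ) G)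
  {C : Set} (_≟_ : DecidableEquality C) where

  open DecMembership _≟_ using (_∈?_)

  -- After clique vertex `i` is coloured by `c`, the list of `v` is still full, so `v` serves as the
  -- vertex `v₀` of `joinColourable`. All lists on `G` keep more than `s` colours, so each term of
  -- the demand is at most a degree and the demand is at most 2m.
  differingLists : ∀ {s LV} {LA : Fin (suc s) → List C} {i v c} → 3 * edgeCount G ≤ suc s →
    (∀ v → Unique (LV v)) → (∀ i → Unique (LA i)) →
    (∀ v → length (LV v) ≡ κ + suc s) → (∀ i → length (LA i) ≡ κ + suc s) →
    c ∈ LA i → c ∉ LV v → JoinColourable _≟_ G LV LA
  differingLists {s} {LV} {LA} {i} {v} {c} 3m≤ LV! LA! LV≡ LA≡ c∈ c∉ =
    precolour _≟_ G i c c∈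
      (joinColourable _≟_ G κ (deletedColouring G critical) s
        (remove _≟_ c ∘ LV) (remove _≟_ c ∘ LA ∘ punchIn i) v
        (filter⁺ _ ∘ LV!) (filter⁺ _ ∘ LA! ∘ punchIn i)
        (λ j → ≤-pred (≤-trans (≤-reflexive (trans (sym (+-suc κ s)) (sym (LA≡ (punchIn i j)))))
          (length-remove _≟_ (LA! (punchIn i j)))))
        (≤-reflexive (trans (sym (+-suc κ s)) (sym LV′v≡)))
        (≤-trans (sum-mono λ w → m≤n+o⇒m∸n≤o _ _ (term≤ w))
          (≤-trans (handshake G) (double≤ (edgeCount G) 3m≤))))
    where
    LV′ : Fin n → List C
    LV′ = remove _≟_ c ∘ LV

    LV′v≡ : length (LV′ v) ≡ κ + suc s
    LV′v≡ = trans (cong length (filter-all _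
      (All.tabulate λ x∈ x≡c → c∉ (subst (_∈ LV v) x≡c x∈)))) (LV≡ v)

    -- If κ ≥ 1, at most one of the κ + s + 1 colours is lost; if κ = 0, then v is the only vertex.
    LV′> : ∀ w → s < length (LV′ w)
    LV′> w with w Fin.≟ v
    ... | yes refl = ≤-trans (m≤n+m (suc s) κ) (≤-reflexive (sym LV′v≡))
    ... | no w≢v   = ≤-pred (≤-trans
      (+-monoˡ-≤ (suc s) (≤-trans (s≤s z≤n) (Fin.toℕ<n (proj₁ (deletedColouring G critical v) w w≢v))))
      (≤-trans (≤-reflexive (sym (LV≡ w))) (length-remove _≟_ (LV! w))))

    term≤ : ∀ w → suc (degree G w + s) ≤ length (LV′ w) + degree G w
    term≤ w = ≤-trans (≤-reflexive (cong suc (+-comm (degree G w) s))) (+-monoˡ-≤ (degree G w) (LV′> w))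

  bad⇒constant : ∀ t → 3 * edgeCount G ≤ t → (L : ListAssignment (Fin n ⊎ Fin t) C) →
    IsAssignmentOfSize (κ + t) L → Bad (G ∨ K t) L → Constant (κ + t) L
  bad⇒constant zero 3m≤0 L size≡ _ =
    record { elements = [] ; unique = [] } , sym κ+0≡0 ,
    λ x → subst (_∼[ set ] []) (sym (length≡0 (trans (size≡ x) κ+0≡0))) (mk⇔ id id)
    where
    κ+0≡0 : κ + 0 ≡ 0
    κ+0≡0 = trans (+-identityʳ κ) (edgeless-χ G (proj₁ critical)
      (n≤0⇒n≡0 (≤-trans (m≤m+n _ _) 3m≤0)))
  bad⇒constant (suc s) 3m≤ L size≡ bad
    with Fin.any? (λ i → Fin.any? λ v → anyList? (λ c → ¬? (c ∈? LV v)) (LA i))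
    where
    LV : Fin n → List C
    LV = elements ∘ L ∘ inj₁
    LA : Fin (suc s) → List C
    LA = elements ∘ L ∘ inj₂
  ... | yes (i , v , some) with find some
  ...   | c , c∈ , c∉ with differingLists 3m≤ (unique ∘ L ∘ inj₁) (unique ∘ L ∘ inj₂)
                             (size≡ ∘ inj₁) (size≡ ∘ inj₂) c∈ c∉
  ...     | g , h , g∈ , g-proper , (h∈ , h-inj) , g≢h = contradiction (f , f∈ , f-proper) bad
    where
    f : Fin n ⊎ Fin (suc s) → C
    f = [ g , h ]′

    f∈ : ∀ x → f x ∈ elements (L x)
    f∈ (inj₁ v) = g∈ v
    f∈ (inj₂ i) = h∈ i

    f-proper : Proper (G ∨ K (suc s)) f
    f-proper (inj₁ u) (inj₁ v) a = g-proper u v a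
    f-proper (inj₁ v) (inj₂ i) _ = g≢h v i
    f-proper (inj₂ i) (inj₁ v) _ = g≢h v i ∘ sym
    f-proper (inj₂ i) (inj₂ j) a = a ∘ h-inj i j
  bad⇒constant (suc s) 3m≤ L size≡ bad | no none =
    L (inj₂ zero) , size≡ (inj₂ zero) , same
    where
    LA⊆LV : ∀ i v {c} → c ∈ elements (L (inj₂ i)) → c ∈ elements (L (inj₁ v))
    LA⊆LV i v {c} c∈ = decidable-stable (c ∈? _) λ c∉ → none (i , v , lose c∈ c∉)

    LV⊆LA : ∀ i v {c} → c ∈ elements (L (inj₁ v)) → c ∈ elements (L (inj₂ i))
    LV⊆LA i v = ⊆-length-⊇ _≟_ (unique (L (inj₂ i))) (unique (L (inj₁ v)))
      (≤-reflexive (trans (size≡ (inj₁ v)) (sym (size≡ (inj₂ i))))) (LA⊆LV i v)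

    -- Two clique lists are compared through the list of a vertex of `G`, which exists since the
    -- chromatic number is positive. The order of the graph is generalised to allow a case split.
    vertex : ∀ {n} (G : Graph (Fin n)) → HasChromaticNumber G (suc κ) → Fin n
    vertex {zero}  _ (_ , least) = contradiction (least 0 ((λ ()) , λ ())) λ ()
    vertex {suc _} _ _         = zero

    v₀ : Fin n
    v₀ = vertex G (proj₁ critical)

    same : ∀ x → elements (L x) ∼[ set ] elements (L (inj₂ zero))
    same (inj₁ v) = mk⇔ (LV⊆LA zero v) (LA⊆LV zero v)
    same (inj₂ i) = mk⇔ (LV⊆LA zero v₀ ∘ LA⊆LV i v₀) (LV⊆LA i v₀ ∘ LA⊆LV zero v₀)

theorem1p6 : ∀ {n : ℕ} (G : Graph (Fin n)) (m : ℕ) → VertexCritical G → edgeCount G ≡ m →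
    ∀ (t : ℕ) → t ≥ 3 * m → StronglyChromaticChoosable (G ∨ K t)
theorem1p6 G m (suc κ , _ , critical) refl t t≥3m =
  -- With the summands in this order, `k ∸ 1` computes to the `κ + t` of `bad⇒constant`.
  suc κ + t , s≤s z≤n ,
  subst (λ k → VertexCriticalAt k (G ∨ K t)) (+-comm t (suc κ)) (join-critical G t critical) ,
  λ _≟_ → bad⇒constant G critical _≟_ t t≥3m
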